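{- Let $n\ge 1$ and let $A^1,\ldots,A^n$ be finite simple graphs containing no isolated vertices. Then \[ \prod_{i=1}^{n}\gamma_{pr}(A^i) \le 2^{n-1}(2n-1)\,\gamma_{pr}(A^1\Box\cdots\Box A^n). \]
   Context: All graphs are finite, simple and undirected. For a graph $G$ and vertex $v$, $N_G[v]$ denotes the closed neighborhood of $v$. A dominating set of $G$ is a set $D\subseteq V(G)$ with $N_G[v]\cap D\neq\emptyset$ for all $v$. A paired dominating set is a dominating set $D$ such that the induced subgraph $G[D]$ has a perfect matching; $\gamma_{pr}(G)$ is the minimum size of a paired dominating set. The Cartesian product $A^1\Box\cdots\Box A^n$ has vertex set $V(A^1)\times\cdots\times V(A^n)$, with $u^1\cdots u^n$ and $v^1\cdots v^n$ adjacent iff for some index $i$, $u^iv^i\in E(A^i)$ and $u^j=v^j$ for all $j\neq i$. -}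

module Defs where

open import Data.Nat using (ℕ; zero; suc; _*_; _≤_)
open import Data.Fin using (Fin; zero; suc)
open import Data.Product using (Σ; ∃; _×_; _,_)
open import Data.Sum using (_⊎_; inj₁; inj₂)
open import Data.Unit using (⊤; tt)
open import Data.Empty using (⊥)
open import Data.List using (List; []; _∷_; length; concatMap)
open import Data.List.Membership.Propositional using (_∈_)
open import Data.List.Relation.Unary.Unique.Propositional using (Unique)
open import Data.List.Relation.Binary.Permutation.Propositional using (_↭_)
open import Relation.Binary.PropositionalEquality using (_≡_; refl; sym)
open import Function using (_∘_)

record Graph (V : Set) : Set₁ where
  field
    Adj    : V → V → Set
    symm   : ∀ {u v} → Adj u v → Adj v u
    irrefl : ∀ {v} → Adj v v → ⊥
open Graph public

-- A finite simple graph with m vertices is a Graph (Fin m).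

NoIsolated : ∀ {V} → Graph V → Set
NoIsolated {V} G = ∀ (v : V) → ∃ λ u → Adj G v u

Dominating : ∀ {V} → Graph V → List V → Set
Dominating {V} G D = ∀ (v : V) → ∃ λ u → u ∈ D × (u ≡ v ⊎ Adj G v u)

Edge : ∀ {V} → Graph V → Set
Edge {V} G = Σ (V × V) λ { (u , v) → Adj G u v }

endpoints : ∀ {V} {G : Graph V} → Edge G → List V
endpoints ((u , v) , _) = u ∷ v ∷ []

-- G[D] has a perfect matching: a list of edges of G whose endpoints list
-- is a permutation of D (so edges are disjoint, and cover D, inside D).
HasPerfectMatching : ∀ {V} → (G : Graph V) → List V → Set
HasPerfectMatching G D = ∃ λ (M : List (Edge G)) → concatMap (endpoints {G = G}) M ↭ D

HasPDSetOfSize : ∀ {V} → Graph V → ℕ → Set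
HasPDSetOfSize {V} G k =
  ∃ λ (D : List V) → Unique D × length D ≡ k × Dominating G D × HasPerfectMatching G D

IsGammaPr : ∀ {V} → Graph V → ℕ → Set
IsGammaPr G k = HasPDSetOfSize G k × (∀ k' → HasPDSetOfSize G k' → k ≤ k')

ProdV : (n : ℕ) → (Fin n → ℕ) → Set
ProdV zero m = ⊤
ProdV (suc n) m = Fin (m zero) × ProdV n (m ∘ suc)

ProdAdj : (n : ℕ) (m : Fin n → ℕ) → ((i : Fin n) → Graph (Fin (m i))) →
          ProdV n m → ProdV n m → Set
ProdAdj zero m A x y = ⊥
ProdAdj (suc n) m A (a , x) (b , y) =
  (Adj (A zero) a b × x ≡ y) ⊎ (a ≡ b × ProdAdj n (m ∘ suc) (A ∘ suc) x y)

private
  prodSym : ∀ n m A {x y} → ProdAdj n m A x y → ProdAdj n m A y x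
  prodSym zero m A ()
  prodSym (suc n) m A (inj₁ (e , p)) = inj₁ (symm (A zero) e , sym p)
  prodSym (suc n) m A (inj₂ (p , e)) = inj₂ (sym p , prodSym n (m ∘ suc) (A ∘ suc) e)

  prodIrr : ∀ n m A {x} → ProdAdj n m A x x → ⊥
  prodIrr zero m A ()
  prodIrr (suc n) m A (inj₁ (e , _)) = irrefl (A zero) e
  prodIrr (suc n) m A (inj₂ (_ , e)) = prodIrr n (m ∘ suc) (A ∘ suc) e

□ : (n : ℕ) (m : Fin n → ℕ) → ((i : Fin n) → Graph (Fin (m i))) → Graph (ProdV n m)
□ n m A = record { Adj = ProdAdj n m A ; symm = prodSym n m A ; irrefl = prodIrr n m A }

prodFin : (n : ℕ) → (Fin n → ℕ) → ℕ
prodFin zero f = 1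
prodFin (suc n) f = f zero * prodFin n (f ∘ suc)

{-# OPTIONS --safe #-}
module Submission where

-- Write γpr(Aⁱ) = 2kᵢ. The closed neighbourhoods of the kᵢ edges of a minimum pairing of Aⁱ give
-- a partition into kᵢ blocks, hence ∏ kᵢ boxes in the product. For every box some direction i
-- exists in which D dominates the whole i-th block from within the fibre of boxes through it:
-- otherwise an undominated point in each direction could be picked, and the point with these
-- coordinates would be undominated. By minimality, a fibre in direction i accounts for at most as many
-- boxes as there are matching edges of D, possibly shrunk to a vertex, meeting it. A matching
-- edge meets one fibre in its own direction and at most two in each of the other n − 1, so
-- ∏ kᵢ ≤ (2n − 1)|D|/2. Directions are peeled off one at a time, so the induction is over families
-- of edges and vertices, weighted 2n − 1 and n. Adjacency need not be decidable, but the graphs are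
-- finite and the conclusion is ¬¬-stable.

open import Defs
open import Data.Bool using (if_then_else_)
open import Data.Empty using (⊥; ⊥-elim)
open import Data.Nat using (ℕ; zero; suc; _+_; _*_; _^_; _∸_; _≤_; _≤?_; z≤n; s≤s)
open import Data.Nat.Properties
open import Data.Nat.ListAction using (sum)
open import Data.Nat.ListAction.Properties using (sum-++)
open import Data.Nat.Solver using (module +-*-Solver)
open import Data.Fin using (Fin; zero; suc)
import Data.Fin.Properties as Fin
open import Data.List using (List; []; _∷_; _++_; map; length; concatMap; lookup; allFin; cartesianProduct)
open import Data.List.Properties using (map-++; map-∘; length-++; length-tabulate)
open import Data.List.Relation.Unary.All using (All; []; _∷_)
open import Data.List.Relation.Unary.All.Properties using (¬Any⇒All¬)
open import Data.List.Relation.Unary.AllPairs using ([]; _∷_)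
open import Data.List.Relation.Unary.Any as Any using (Any; here; there)
open import Data.List.Relation.Unary.Any.Properties using (concatMap⁺; concatMap⁻; map⁺; ++⁺ˡ; ++⁺ʳ; lookup-index)
open import Data.List.Relation.Unary.Unique.Propositional using (Unique)
import Data.List.Relation.Unary.Unique.Propositional.Properties as Unique
open import Data.List.Relation.Binary.Permutation.Propositional using (_↭_; ↭-refl; ↭-sym)
open import Data.List.Relation.Binary.Permutation.Propositional.Properties using (∈-resp-↭; ↭-length)
open import Data.List.Membership.Propositional using (_∈_; _∉_; lose; find)
open import Data.List.Membership.Propositional.Properties using (∈-allFin)
open import Data.Product using (∃; _×_; _,_; proj₁; proj₂)
open import Data.Product.Properties using () renaming (≡-dec to ×-≡-dec)
open import Data.Sum using (_⊎_; inj₁; inj₂)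
open import Data.Unit using (⊤; tt)
open import Effect.Monad using (RawMonad)
open import Function using (_∘_; const; id)
open import Relation.Binary using (Decidable; DecidableEquality)
import Relation.Unary as Unary
open import Relation.Binary.PropositionalEquality using (_≡_; refl; sym; trans; cong; cong₂; subst; module ≡-Reasoning)
open import Relation.Nullary using (Dec; yes; no; ¬_; contradiction; does)
open import Relation.Nullary.Decidable using (_×-dec_; _⊎-dec_; _→-dec_; ¬?; decidable-stable; ¬¬-excluded-middle)
open import Relation.Nullary.Negation using (¬¬-Monad)

open +-*-Solver using (solve; _:+_; _:*_; _:=_; con)

private variable
  X Y V : Set

-- Finite sums over lists

∑ : List X → (X → ℕ) → ℕ
∑ xs f = sum (map f xs)

∑-mono : ∀ (xs : List X) {f g : X → ℕ} → (∀ x → f x ≤ g x) → ∑ xs f ≤ ∑ xs g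
∑-mono []       f≤g = z≤n
∑-mono (x ∷ xs) f≤g = +-mono-≤ (f≤g x) (∑-mono xs f≤g)

∑-cong : ∀ (xs : List X) {f g : X → ℕ} → (∀ x → f x ≡ g x) → ∑ xs f ≡ ∑ xs g
∑-cong []       f≡g = refl
∑-cong (x ∷ xs) f≡g = cong₂ _+_ (f≡g x) (∑-cong xs f≡g)

∑-zero : ∀ (xs : List X) → ∑ xs (const 0) ≡ 0
∑-zero []       = refl
∑-zero (x ∷ xs) = ∑-zero xs

∑-one : ∀ (xs : List X) → ∑ xs (const 1) ≡ length xs
∑-one []       = refl
∑-one (x ∷ xs) = cong suc (∑-one xs)

∑-const : ∀ (xs : List X) c → ∑ xs (const c) ≡ length xs * c
∑-const []       c = refl
∑-const (x ∷ xs) c = cong (c +_) (∑-const xs c)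

∑-+ : ∀ (xs : List X) (f g : X → ℕ) → ∑ xs (λ x → f x + g x) ≡ ∑ xs f + ∑ xs g
∑-+ []       f g = refl
∑-+ (x ∷ xs) f g = trans (cong (f x + g x +_) (∑-+ xs f g)) (solve 4 (λ a b c d → a :+ b :+ (c :+ d) := a :+ c :+ (b :+ d)) refl (f x) (g x) _ _)

∑-++ : ∀ (xs ys : List X) (f : X → ℕ) → ∑ (xs ++ ys) f ≡ ∑ xs f + ∑ ys f
∑-++ xs ys f = trans (cong sum (map-++ f xs ys)) (sum-++ (map f xs) (map f ys))

∑-swap : ∀ (xs : List X) (ys : List Y) (f : X → Y → ℕ) →
  ∑ xs (λ x → ∑ ys (f x)) ≡ ∑ ys (λ y → ∑ xs (λ x → f x y))
∑-swap []       ys f = sym (∑-zero ys)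
∑-swap (x ∷ xs) ys f = trans (cong (∑ ys (f x) +_) (∑-swap xs ys f)) (sym (∑-+ ys (f x) _))

∑-concatMap : ∀ (g : X → List Y) (xs : List X) (f : Y → ℕ) →
  ∑ (concatMap g xs) f ≡ ∑ xs (λ x → ∑ (g x) f)
∑-concatMap g []       f = refl
∑-concatMap g (x ∷ xs) f = trans (∑-++ (g x) _ f) (cong (∑ (g x) f +_) (∑-concatMap g xs f))

∑-cartesianProduct : ∀ (xs : List X) (ys : List Y) (f : X × Y → ℕ) →
  ∑ (cartesianProduct xs ys) f ≡ ∑ xs (λ x → ∑ ys (λ y → f (x , y)))
∑-cartesianProduct []       ys f = refl
∑-cartesianProduct (x ∷ xs) ys f = trans (∑-++ (map (x ,_) ys) _ f)
  (cong₂ _+_ (cong sum (sym (map-∘ ys))) (∑-cartesianProduct xs ys f))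

length-concatMap : ∀ (g : X → List Y) (xs : List X) → length (concatMap g xs) ≡ ∑ xs (length ∘ g)
length-concatMap g []       = refl
length-concatMap g (x ∷ xs) = trans (length-++ (g x)) (cong (length (g x) +_) (length-concatMap g xs))

-- Indicators and selections

when : {P : Set} → Dec P → X → List X
when p? x = if does p? then x ∷ [] else []

⟦_⟧ : {P : Set} → Dec P → ℕ
⟦ p? ⟧ = if does p? then 1 else 0

when⁺ : {P : Set} (p? : Dec P) {x : X} {Q : X → Set} → P → Q x → Any Q (when p? x)
when⁺ (yes _) p q = here q
when⁺ (no ¬p) p q = contradiction p ¬p

⟦⟧-split : {P Q : Set} (p? : Dec P) (q? : Dec Q) → ⟦ p? ⟧ ≤ ⟦ q? ⟧ + ⟦ p? ×-dec ¬? q? ⟧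
⟦⟧-split (no _)  q?      = z≤n
⟦⟧-split (yes _) (yes _) = s≤s z≤n
⟦⟧-split (yes _) (no _)  = s≤s z≤n

⟦⟧-all : {P : Set} (p? : Dec P) → P → ⟦ p? ⟧ ≡ 1
⟦⟧-all (yes _) _ = refl
⟦⟧-all (no ¬p) p = contradiction p ¬p

⟦⟧-complement : {P : Set} (p? : Dec P) (y : Y) → ⟦ p? ⟧ + length (when (¬? p?) y) ≡ 1
⟦⟧-complement (yes _) _ = refl
⟦⟧-complement (no _)  _ = refl

module _ (_≟_ : DecidableEquality X) (x : X) (y : Y) (w : Y → ℕ) where

  ∑-when-∉ : ∀ {xs} → All (λ a → ¬ x ≡ a) xs → ∑ xs (λ a → ∑ (when (x ≟ a) y) w) ≡ 0
  ∑-when-∉ [] = refl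
  ∑-when-∉ {a ∷ _} (x≢a ∷ x∉xs) with x ≟ a
  ... | yes x≡a = contradiction x≡a x≢a
  ... | no  _   = ∑-when-∉ x∉xs

  -- In a duplicate-free list at most one entry equals `x`, so `y` is charged at most once.
  ∑-when : ∀ {xs} → Unique xs → ∑ xs (λ a → ∑ (when (x ≟ a) y) w) ≤ w y
  ∑-when [] = z≤n
  ∑-when {a ∷ _} (a∉xs ∷ u) with x ≟ a
  ... | yes refl = ≤-reflexive (trans (cong₂ _+_ (+-identityʳ (w y)) (∑-when-∉ a∉xs)) (+-identityʳ (w y)))
  ... | no  _    = ∑-when u

∑-when₂ : ∀ (_≟_ : DecidableEquality X) (x x′ : X) (y : Y) (w : Y → ℕ) {xs} → Unique xs →
  ∑ xs (λ a → ∑ (when (x ≟ a) y ++ when (x′ ≟ a) y) w) ≤ w y + w y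
∑-when₂ _≟_ x x′ y w {xs} u = begin
  ∑ xs (λ a → ∑ (when (x ≟ a) y ++ when (x′ ≟ a) y) w)
    ≡⟨ ∑-cong xs (λ a → ∑-++ (when (x ≟ a) y) _ w) ⟩
  ∑ xs (λ a → ∑ (when (x ≟ a) y) w + ∑ (when (x′ ≟ a) y) w)
    ≡⟨ ∑-+ xs _ _ ⟩
  ∑ xs (λ a → ∑ (when (x ≟ a) y) w) + ∑ xs (λ a → ∑ (when (x′ ≟ a) y) w)
    ≤⟨ +-mono-≤ (∑-when _≟_ x y w u) (∑-when _≟_ x′ y w u) ⟩
  w y + w y ∎
  where open ≤-Reasoning

-- Edges and vertices as dominating items

length-endpoints : ∀ {G : Graph V} (M : List (Edge G)) → length (concatMap (endpoints {G = G}) M) ≡ length M * 2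
length-endpoints         []      = refl
length-endpoints {G = G} (e ∷ M) = cong (2 +_) (length-endpoints {G = G} M)

-- Projecting a product edge to a factor in which its ends agree leaves a single vertex, so families
-- of edges alone would not be closed under projection.
data Item {V : Set} (G : Graph V) : Set where
  vertex : V → Item G
  edge   : Edge G → Item G

ends : {G : Graph V} → Item G → List V
ends         (vertex v) = v ∷ []
ends {G = G} (edge e)   = endpoints {G = G} e

Meets : {G : Graph V} → (V → Set) → List (Item G) → Set
Meets P = Any (Any P ∘ ends)

Near : Graph V → V → V → Set
Near G x z = z ≡ x ⊎ Adj G x z

-- Turning items into a matching

module Pairing {m} (G : Graph (Fin m)) (adj? : Decidable (Adj G)) (noIso : NoIsolated G) where

  open import Data.List.Membership.DecPropositional (Fin._≟_ {m}) using (_∈?_)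

  vertices : List (Edge G) → List (Fin m)
  vertices = concatMap (endpoints {G = G})

  near? : Decidable (Near G)
  near? x z = (z Fin.≟ x) ⊎-dec adj? x z

  -- `gains` asks that `M′` dominate whatever `us` dominates, not that it contain `us`: a vertex
  -- with all its neighbours already matched cannot be paired.
  record Extension (M : List (Edge G)) (us : List (Fin m)) : Set where
    constructor extension
    field
      M′       : List (Edge G)
      disjoint : Unique (vertices M′)
      size     : length M′ ≤ suc (length M)
      keeps    : ∀ x → Any (Near G x) (vertices M) → Any (Near G x) (vertices M′)
      gains    : ∀ x → Any (Near G x) us → Any (Near G x) (vertices M′)

  addEdge : ∀ M → Unique (vertices M) → ∀ u v → Adj G u v →
    u ∉ vertices M → v ∉ vertices M → Extension M (u ∷ v ∷ [])
  addEdge M uniq u v uv u∉ v∉ = extension (((u , v) , uv) ∷ M)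
    (((λ { refl → irrefl G uv }) ∷ ¬Any⇒All¬ _ u∉) ∷ ¬Any⇒All¬ _ v∉ ∷ uniq)
    ≤-refl
    (λ _ p → there (there p))
    (λ { _ (here p) → here p ; _ (there (here p)) → there (here p) })

  -- If v has no neighbour left to be matched with, all of N[v] is already dominated.
  addVertex : ∀ M → Unique (vertices M) → ∀ v → Extension M (v ∷ [])
  addVertex M uniq v with v ∈? vertices M
  ... | yes v∈ = extension M uniq (n≤1+n _) (λ _ p → p) (λ { _ (here p) → lose v∈ p })
  ... | no v∉ with Fin.any? (λ c → adj? v c ×-dec ¬? (c ∈? vertices M))
  ... | yes (c , vc , c∉) = let extension M′ d s k g = addEdge M uniq v c vc v∉ c∉ in
    extension M′ d s k (λ { x (here p) → g x (here p) })
  ... | no none = extension M uniq (n≤1+n _) (λ _ p → p) gains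
    where
    nbr∈ : ∀ {c} → Adj G v c → c ∈ vertices M
    nbr∈ {c} vc = decidable-stable (c ∈? vertices M) (λ c∉ → none (c , vc , c∉))
    gains : ∀ x → Any (Near G x) (v ∷ []) → Any (Near G x) (vertices M)
    gains x (here (inj₁ refl)) = let u , vu = noIso v in lose (nbr∈ vu) (inj₂ vu)
    gains x (here (inj₂ xv))   = lose (nbr∈ (symm G xv)) (inj₁ refl)

  -- If one end is already matched, only the other still needs treatment, so one new edge is enough
  -- in every case.
  addItem : ∀ M → Unique (vertices M) → ∀ d → Extension M (ends {G = G} d)
  addItem M uniq (vertex v) = addVertex M uniq v
  addItem M uniq (edge ((u , v) , uv)) with u ∈? vertices M | v ∈? vertices M
  ... | no u∉ | no v∉ = addEdge M uniq u v uv u∉ v∉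
  ... | yes u∈ | _ = let extension M′ d s k g = addVertex M uniq v in
    extension M′ d s k (λ { x (here p) → k x (lose u∈ p) ; x (there p) → g x p })
  ... | no _ | yes v∈ = let extension M′ d s k g = addVertex M uniq u in
    extension M′ d s k (λ { x (here p) → g x (here p) ; x (there (here p)) → k x (lose v∈ p) })

  -- Each item costs at most one edge, even when items overlap or are mere vertices. This makes
  -- minimality of a paired dominating set applicable to arbitrary items.
  pairing : ∀ (I : List (Item G)) → ∃ λ M → Unique (vertices M) × length M ≤ length I ×
    (∀ x → Meets (Near G x) I → Any (Near G x) (vertices M))
  pairing [] = [] , [] , z≤n , λ _ ()
  pairing (d ∷ I) with pairing I
  ... | M , uniq , M≤I , dom = let extension M′ uniq′ s k g = addItem M uniq d in
    M′ , uniq′ , ≤-trans s (s≤s M≤I) , λ { x (here p) → g x p ; x (there p) → k x (dom x p) }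

-- Blocks of a minimum paired dominating set

-- The form in which minimality is used: dominating all blocks of a family `P` takes at least as
-- many items as the family has blocks.
record Blocks {m} (G : Graph (Fin m)) (k : ℕ) : Set₁ where
  field
    block : Fin m → Fin k
    bound : {P : Fin k → Set} (P? : Unary.Decidable P) (I : List (Item G)) →
      (∀ x → P (block x) → Meets (Near G x) I) → ∑ (allFin k) (λ a → ⟦ P? a ⟧) ≤ length I

-- The blocks are closed neighbourhoods of the edges of a minimum pairing, overlaps being
-- resolved arbitrarily; replacing the edges of the blocks met by I by I itself
-- cannot give a smaller pairing.
module _ {m} (G : Graph (Fin m)) (adj? : Decidable (Adj G)) (noIso : NoIsolated G) where

  open Pairing G adj? noIso

  blocks : ∀ {g} → IsGammaPr G g → ∃ λ k → g ≡ k * 2 × Blocks G k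
  blocks {g} ((D , _ , |D|≡g , dom , M , M↭D) , minimal) =
    length M , g≡ , record { block = block ; bound = bound }
    where
    k : ℕ
    k = length M

    g≡ : g ≡ k * 2
    g≡ = trans (sym |D|≡g) (trans (sym (↭-length M↭D)) (length-endpoints {G = G} M))

    dominator : ∀ x → Any (Any (Near G x) ∘ endpoints {G = G}) M
    dominator x = let u , u∈D , near = dom x in
      concatMap⁻ (endpoints {G = G}) {xs = M} (lose (∈-resp-↭ (↭-sym M↭D) u∈D) near)

    block : Fin m → Fin k
    block x = Any.index (dominator x)

    module _ {P : Fin k → Set} (P? : Unary.Decidable P) (I : List (Item G))
             (meets : ∀ x → P (block x) → Meets (Near G x) I) where

      unmet : Fin k → List (Item G)
      unmet a = when (¬? (P? a)) (edge (lookup M a))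

      J : List (Item G)
      J = I ++ concatMap unmet (allFin k)

      J-meets : ∀ x → Meets (Near G x) J
      J-meets x with P? (block x)
      ... | yes p = ++⁺ˡ (meets x p)
      ... | no ¬p = ++⁺ʳ I (concatMap⁺ unmet (lose (∈-allFin (block x))
                      (when⁺ (¬? (P? (block x))) ¬p (lookup-index (dominator x)))))

      length-J : ∑ (allFin k) (λ a → ⟦ P? a ⟧) + length J ≡ length I + k
      length-J = begin
        ∑ (allFin k) (λ a → ⟦ P? a ⟧) + length J
          ≡⟨ cong (∑ (allFin k) (λ a → ⟦ P? a ⟧) +_) (trans (length-++ I) (cong (length I +_) (length-concatMap unmet (allFin k)))) ⟩
        ∑ (allFin k) (λ a → ⟦ P? a ⟧) + (length I + ∑ (allFin k) (length ∘ unmet))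
          ≡⟨ solve 3 (λ p i u → p :+ (i :+ u) := i :+ (p :+ u)) refl (∑ (allFin k) (λ a → ⟦ P? a ⟧)) (length I) _ ⟩
        length I + (∑ (allFin k) (λ a → ⟦ P? a ⟧) + ∑ (allFin k) (length ∘ unmet))
          ≡⟨ cong (length I +_) (sym (∑-+ (allFin k) _ _)) ⟩
        length I + ∑ (allFin k) (λ a → ⟦ P? a ⟧ + length (unmet a))
          ≡⟨ cong (length I +_) (∑-cong (allFin k) (λ a → ⟦⟧-complement (P? a) _)) ⟩
        length I + ∑ (allFin k) (const 1)
          ≡⟨ cong (length I +_) (trans (∑-one (allFin k)) (length-tabulate id)) ⟩
        length I + k ∎
        where open ≡-Reasoning

      paired : HasPDSetOfSize G (length (vertices (proj₁ (pairing J))))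
      paired = let M′ , uniq , _ , near = pairing J in
        vertices M′ , uniq , refl , (λ x → let u , u∈ , n = find (near x (J-meets x)) in u , u∈ , n) , M′ , ↭-refl

      k≤J : k ≤ length J
      k≤J = let M′ , _ , M′≤J , _ = pairing J in ≤-trans
        -- Minimality compares numbers of vertices; halving both sides compares numbers of edges.
        (*-cancelʳ-≤ k (length M′) 2 (subst (_≤ length M′ * 2) g≡ (subst (g ≤_) (length-endpoints {G = G} M′) (minimal _ paired))))
        M′≤J

      bound : ∑ (allFin k) (λ a → ⟦ P? a ⟧) ≤ length I
      bound = +-cancelʳ-≤ k _ _ (≤-trans (+-monoʳ-≤ _ k≤J) (≤-reflexive length-J))

NearP : ∀ n m (A : (i : Fin n) → Graph (Fin (m i))) → ProdV n m → ProdV n m → Set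
NearP zero    m A x y = ⊥
NearP (suc n) m A (a , x) (b , y) =
  (Near (A zero) a b × x ≡ y) ⊎ (a ≡ b × NearP n (m ∘ suc) (A ∘ suc) x y)

ProdAdj⇒NearP : ∀ n m A {x y} → ProdAdj n m A x y → NearP n m A x y
ProdAdj⇒NearP (suc n) m A (inj₁ (e , p)) = inj₁ (inj₂ e , p)
ProdAdj⇒NearP (suc n) m A (inj₂ (p , e)) = inj₂ (p , ProdAdj⇒NearP n (m ∘ suc) (A ∘ suc) e)

≡-decᴾ : ∀ n k → DecidableEquality (ProdV n k)
≡-decᴾ zero    k tt tt = yes refl
≡-decᴾ (suc n) k       = ×-≡-dec Fin._≟_ (≡-decᴾ n (k ∘ suc))

boxes : ∀ n k → List (ProdV n k)
boxes zero    k = tt ∷ []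
boxes (suc n) k = cartesianProduct (allFin (k zero)) (boxes n (k ∘ suc))

boxes-unique : ∀ n k → Unique (boxes n k)
boxes-unique zero    k = [] ∷ []
boxes-unique (suc n) k = Unique.cartesianProduct⁺ (Unique.allFin⁺ (k zero)) (boxes-unique n (k ∘ suc))

∑-boxes-one : ∀ n k → ∑ (boxes n k) (const 1) ≡ prodFin n k
∑-boxes-one zero    k = refl
∑-boxes-one (suc n) k = begin
  ∑ (boxes (suc n) k) (const 1)
    ≡⟨ ∑-cartesianProduct (allFin (k zero)) (boxes n (k ∘ suc)) _ ⟩
  ∑ (allFin (k zero)) (λ _ → ∑ (boxes n (k ∘ suc)) (const 1))
    ≡⟨ ∑-cong (allFin (k zero)) (λ _ → ∑-boxes-one n (k ∘ suc)) ⟩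
  ∑ (allFin (k zero)) (const (prodFin n (k ∘ suc)))
    ≡⟨ ∑-const (allFin (k zero)) _ ⟩
  length (allFin (k zero)) * prodFin n (k ∘ suc)
    ≡⟨ cong (_* prodFin n (k ∘ suc)) (length-tabulate {n = k zero} id) ⟩
  prodFin (suc n) k ∎
  where open ≡-Reasoning

boxOf : ∀ n {m k} {A : (i : Fin n) → Graph (Fin (m i))} → (∀ i → Blocks (A i) (k i)) → ProdV n m → ProdV n k
boxOf zero    B tt      = tt
boxOf (suc n) B (x , y) = Blocks.block (B zero) x , boxOf n (B ∘ suc) y

-- This is 2n - 1: one for the direction of the edge, two for each other direction. For n = 0 there
-- are no edges.
edgeWeight : ℕ → ℕ
edgeWeight zero    = 0
edgeWeight (suc n) = suc (n + n)

weight : ∀ {n m A} → Item (□ n m A) → ℕ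
weight {n} (vertex _) = n
weight {n} (edge _)   = edgeWeight n

-- Peeling off the first factor

module Step n (m : Fin (suc n) → ℕ) (A : (i : Fin (suc n)) → Graph (Fin (m i)))
            {k : Fin (suc n) → ℕ} (B : ∀ i → Blocks (A i) (k i)) where

  G : Graph (Fin (m zero))
  G = A zero

  R : Graph (ProdV n (m ∘ suc))
  R = □ n (m ∘ suc) (A ∘ suc)

  β : Fin (m zero) → Fin (k zero)
  β = Blocks.block (B zero)

  ρ : ProdV n (m ∘ suc) → ProdV n (k ∘ suc)
  ρ = boxOf n (B ∘ suc)

  _≟R_ : DecidableEquality (ProdV n (k ∘ suc))
  _≟R_ = ≡-decᴾ n (k ∘ suc)

  -- The part of an item over block `a`, projected to the remaining factors. An edge in the first
  -- direction collapses to a vertex and may appear in two slices.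
  slice : Fin (k zero) → Item (□ (suc n) m A) → List (Item R)
  slice a (vertex (x , y)) = when (β x Fin.≟ a) (vertex y)
  slice a (edge (((x , y) , (x′ , _)) , inj₁ _)) =
    when (β x Fin.≟ a) (vertex y) ++ when (β x′ Fin.≟ a) (vertex y)
  slice a (edge (((x , y) , (_ , y′)) , inj₂ (_ , e))) = when (β x Fin.≟ a) (edge ((y , y′) , e))

  -- Dually, the part over box `r` of the remaining factors, projected to the first one; here the
  -- edges in other directions collapse.
  fibre : ProdV n (k ∘ suc) → Item (□ (suc n) m A) → List (Item G)
  fibre r (vertex (x , y)) = when (ρ y ≟R r) (vertex x)
  fibre r (edge (((x , y) , (x′ , _)) , inj₁ (e , _))) = when (ρ y ≟R r) (edge ((x , x′) , e))
  fibre r (edge (((x , y) , (_ , y′)) , inj₂ _)) =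
    when (ρ y ≟R r) (vertex x) ++ when (ρ y′ ≟R r) (vertex x)

  slice-meets : ∀ {Q : ProdV n (m ∘ suc) → Set} a d →
    Any (λ z → β (proj₁ z) ≡ a × Q (proj₂ z)) (ends d) → Meets Q (slice a d)
  slice-meets a (vertex _) (here (p , q)) = when⁺ (_ Fin.≟ a) p (here q)
  slice-meets a (edge (((x , _) , _) , inj₁ _)) (here (p , q)) =
    ++⁺ˡ (when⁺ (β x Fin.≟ a) p (here q))
  slice-meets a (edge (((x , _) , _) , inj₁ (_ , refl))) (there (here (p , q))) =
    ++⁺ʳ (when (β x Fin.≟ a) _) (when⁺ (_ Fin.≟ a) p (here q))
  slice-meets a (edge (((x , _) , _) , inj₂ _)) (here (p , q)) = when⁺ (β x Fin.≟ a) p (here q)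
  slice-meets a (edge (((x , _) , _) , inj₂ (refl , _))) (there (here (p , q))) =
    when⁺ (β x Fin.≟ a) p (there (here q))

  fibre-meets : ∀ {Q : Fin (m zero) → Set} r d →
    Any (λ z → ρ (proj₂ z) ≡ r × Q (proj₁ z)) (ends d) → Meets Q (fibre r d)
  fibre-meets r (vertex _) (here (p , q)) = when⁺ (_ ≟R r) p (here q)
  fibre-meets r (edge (((_ , y) , _) , inj₁ _)) (here (p , q)) = when⁺ (ρ y ≟R r) p (here q)
  fibre-meets r (edge (((_ , y) , _) , inj₁ (_ , refl))) (there (here (p , q))) =
    when⁺ (ρ y ≟R r) p (there (here q))
  fibre-meets r (edge (((_ , y) , _) , inj₂ _)) (here (p , q)) =
    ++⁺ˡ (when⁺ (ρ y ≟R r) p (here q))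
  fibre-meets r (edge (((_ , y) , _) , inj₂ (refl , _))) (there (here (p , q))) =
    ++⁺ʳ (when (ρ y ≟R r) _) (when⁺ (_ ≟R r) p (here q))

  -- An edge of the product costs 1 in its own direction and at most 2 in every other one.
  weight-step : ∀ d →
    ∑ (boxes n (k ∘ suc)) (λ r → ∑ (fibre r d) (const 1)) + ∑ (allFin (k zero)) (λ a → ∑ (slice a d) weight)
      ≤ weight d
  weight-step (vertex (x , y)) = +-mono-≤
    (∑-when _≟R_ (ρ y) (vertex {G = G} x) (const 1) (boxes-unique n (k ∘ suc)))
    (∑-when Fin._≟_ (β x) (vertex {G = R} y) weight (Unique.allFin⁺ (k zero)))
  weight-step (edge (((x , y) , (x′ , _)) , inj₁ (e , _))) = +-mono-≤
    (∑-when _≟R_ (ρ y) (edge {G = G} ((x , x′) , e)) (const 1) (boxes-unique n (k ∘ suc)))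
    (∑-when₂ Fin._≟_ (β x) (β x′) (vertex {G = R} y) weight (Unique.allFin⁺ (k zero)))
  weight-step (edge (((x , y) , (_ , y′)) , inj₂ (_ , e))) = ≤-trans (+-mono-≤
    (∑-when₂ _≟R_ (ρ y) (ρ y′) (vertex {G = G} x) (const 1) (boxes-unique n (k ∘ suc)))
    (∑-when Fin._≟_ (β x) (edge {G = R} ((y , y′) , e)) weight (Unique.allFin⁺ (k zero))))
    (2+edgeWeight n e)
    where
    -- The adjacency rules out n = 0, where the inequality would read 2 ≤ 1.
    2+edgeWeight : ∀ n {m A} {x y : ProdV n m} → ProdAdj n m A x y → 2 + edgeWeight n ≤ edgeWeight (suc n)
    2+edgeWeight (suc n) _ = ≤-reflexive (cong (2 +_) (sym (+-suc n n)))

boxBound : ∀ n m (A : (i : Fin n) → Graph (Fin (m i))) → (∀ i → Decidable (Adj (A i))) →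
  ∀ {k} (B : ∀ i → Blocks (A i) (k i)) {F : ProdV n k → Set} (F? : Unary.Decidable F) (D : List (Item (□ n m A))) →
  (∀ x → F (boxOf n B x) → Meets (NearP n m A x) D) →
  ∑ (boxes n k) (λ b → ⟦ F? b ⟧) ≤ ∑ D weight
boxBound zero m A adj? B F? D meets with F? tt
... | no _  = z≤n
-- With no direction left nothing is near, so the only box cannot belong to `F`.
... | yes f = let _ , _ , p = find (meets tt f) ; _ , _ , q = find p in ⊥-elim q
boxBound (suc n) m A adj? {k} B {F} F? D meets = begin
  ∑ (boxes (suc n) k) (λ b → ⟦ F? b ⟧)
    ≡⟨ ∑-cartesianProduct as rs _ ⟩
  ∑ as (λ a → ∑ rs (λ r → ⟦ F? (a , r) ⟧))
    -- A box of `F` is charged to the first factor or left to the others. Counting `L` outside `F`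
    -- too only enlarges the bound.
    ≤⟨ ∑-mono as (λ a → ∑-mono rs (λ r → ⟦⟧-split (F? (a , r)) (L? r a))) ⟩
  ∑ as (λ a → ∑ rs (λ r → ⟦ L? r a ⟧ + ⟦ rest? a r ⟧))
    ≡⟨ ∑-cong as (λ a → ∑-+ rs _ _) ⟩
  ∑ as (λ a → ∑ rs (λ r → ⟦ L? r a ⟧) + ∑ rs (λ r → ⟦ rest? a r ⟧))
    ≡⟨ ∑-+ as _ _ ⟩
  ∑ as (λ a → ∑ rs (λ r → ⟦ L? r a ⟧)) + ∑ as (λ a → ∑ rs (λ r → ⟦ rest? a r ⟧))
    ≡⟨ cong (_+ ∑ as (λ a → ∑ rs (λ r → ⟦ rest? a r ⟧))) (∑-swap as rs _) ⟩
  ∑ rs (λ r → ∑ as (λ a → ⟦ L? r a ⟧)) + ∑ as (λ a → ∑ rs (λ r → ⟦ rest? a r ⟧))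
    ≤⟨ +-mono-≤ (∑-mono rs L-bound) (∑-mono as rest-bound) ⟩
  ∑ rs (λ r → ∑ D (λ d → ∑ (fibre r d) (const 1))) + ∑ as (λ a → ∑ D (λ d → ∑ (slice a d) weight))
    ≡⟨ cong₂ _+_ (∑-swap rs D _) (∑-swap as D _) ⟩
  ∑ D (λ d → ∑ rs (λ r → ∑ (fibre r d) (const 1))) + ∑ D (λ d → ∑ as (λ a → ∑ (slice a d) weight))
    ≡⟨ sym (∑-+ D _ _) ⟩
  ∑ D (λ d → ∑ rs (λ r → ∑ (fibre r d) (const 1)) + ∑ as (λ a → ∑ (slice a d) weight))
    ≤⟨ ∑-mono D weight-step ⟩
  ∑ D weight ∎
  where
  open ≤-Reasoning
  open Step n m A B

  as : List (Fin (k zero))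
  as = allFin (k zero)

  rs : List (ProdV n (k ∘ suc))
  rs = boxes n (k ∘ suc)

  near? : Decidable (Near G)
  near? x z = (z Fin.≟ x) ⊎-dec adj? zero x z

  fibreMeets? : ∀ r → Unary.Decidable (λ x → Meets (Near G x) (concatMap (fibre r) D))
  fibreMeets? r x = Any.any? (λ d → Any.any? (near? x) (ends {G = G} d)) (concatMap (fibre r) D)

  -- Box (a , r) is charged to the first factor when D dominates block a from within fibre r.
  L : ProdV n (k ∘ suc) → Fin (k zero) → Set
  L r a = ∀ x → β x ≡ a → Meets (Near G x) (concatMap (fibre r) D)

  L? : ∀ r → Unary.Decidable (L r)
  L? r a = Fin.all? (λ x → (β x Fin.≟ a) →-dec fibreMeets? r x)

  rest? : ∀ a → Unary.Decidable (λ r → F (a , r) × ¬ L r a)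
  rest? a r = F? (a , r) ×-dec ¬? (L? r a)

  -- As `L` fails, some `x` in block `a` is not dominated from within the fibre of `ρ y`. Hence
  -- `(x , y)` is not dominated in the first direction, and its dominator projects to one of `y` in
  -- the slice.
  rest-meets : ∀ a y → F (a , ρ y) × ¬ L (ρ y) a → Meets (NearP n (m ∘ suc) (A ∘ suc) y) (concatMap (slice a) D)
  rest-meets a y (f , ¬l)
    with Fin.¬∀⟶∃¬ _ _ (λ x → (β x Fin.≟ a) →-dec fibreMeets? (ρ y) x) ¬l
  ... | x , ¬p with β x Fin.≟ a
  ... | no ≢a = ⊥-elim (¬p (λ ≡a → contradiction ≡a ≢a))
  ... | yes refl with find (meets (x , y) f)
  ... | d , d∈ , p with find p
  ... | z , z∈ , inj₁ (near , refl) = ⊥-elim (¬p (λ _ →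
          concatMap⁺ (fibre (ρ y)) (lose d∈ (fibre-meets (ρ y) d (lose z∈ (refl , near))))))
  ... | z , z∈ , inj₂ (refl , near) =
          concatMap⁺ (slice a) (lose d∈ (slice-meets a d (lose z∈ (refl , near))))

  -- The items seen in fibre `r` dominate every block counted here, so minimality in the first
  -- factor applies.
  L-bound : ∀ r → ∑ as (λ a → ⟦ L? r a ⟧) ≤ ∑ D (λ d → ∑ (fibre r d) (const 1))
  L-bound r = ≤-trans (Blocks.bound (B zero) (L? r) _ (λ x l → l x refl))
    (≤-reflexive (trans (sym (∑-one (concatMap (fibre r) D))) (∑-concatMap (fibre r) D _)))

  rest-bound : ∀ a → ∑ rs (λ r → ⟦ rest? a r ⟧) ≤ ∑ D (λ d → ∑ (slice a d) weight)
  rest-bound a = ≤-trans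
    (boxBound n (m ∘ suc) (A ∘ suc) (adj? ∘ suc) (B ∘ suc) (rest? a) (concatMap (slice a) D) (rest-meets a))
    (≤-reflexive (∑-concatMap (slice a) D weight))

-- Assembling the inequality

prodFin-*2 : ∀ n {f g : Fin n → ℕ} → (∀ i → g i ≡ f i * 2) → prodFin n g ≡ 2 ^ n * prodFin n f
prodFin-*2 zero    g≡ = refl
prodFin-*2 (suc n) {f} g≡ = trans (cong₂ _*_ (g≡ zero) (prodFin-*2 n (g≡ ∘ suc)))
  (solve 3 (λ a t p → (a :* con 2) :* (t :* p) := (con 2 :* t) :* (a :* p)) refl (f zero) (2 ^ n) _)

-- Double-negation shift over a finite index set; it allows all adjacency relations to be assumed
-- decidable at once.
¬¬-Π : ∀ n {P : Fin n → Set} → (∀ i → ¬ ¬ P i) → ¬ ¬ (∀ i → P i)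
¬¬-Π n = Fin.sequence (RawMonad.rawApplicative ¬¬-Monad)

theorem5 : (n : ℕ) → 1 ≤ n → (m : Fin n → ℕ) → (A : (i : Fin n) → Graph (Fin (m i))) →
    (∀ i → NoIsolated (A i)) →
    (g : Fin n → ℕ) → (∀ i → IsGammaPr (A i) (g i)) →
    (h : ℕ) → IsGammaPr (□ n m A) h →
    prodFin n g ≤ (2 ^ (n ∸ 1)) * (2 * n ∸ 1) * h
theorem5 (suc n) _ m A noIso g γ h ((D , _ , |D|≡h , dom , M , M↭D) , _) =
  decidable-stable (_ ≤? _) λ ¬≤ →
    ¬¬-Π (suc n) (λ i → ¬¬-Π (m i) λ u → ¬¬-Π (m i) λ v → ¬¬-excluded-middle) (¬≤ ∘ bounded)
  where
  bounded : (∀ i → Decidable (Adj (A i))) → prodFin (suc n) g ≤ 2 ^ n * (2 * suc n ∸ 1) * h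
  bounded adj? = begin
    prodFin (suc n) g
      ≡⟨ prodFin-*2 (suc n) {f = k} (λ i → proj₁ (proj₂ (B i))) ⟩
    2 ^ suc n * prodFin (suc n) k
      ≡⟨ cong (2 ^ suc n *_) (sym (∑-boxes-one (suc n) k)) ⟩
    2 ^ suc n * ∑ (boxes (suc n) k) (const 1)
      ≤⟨ *-monoʳ-≤ (2 ^ suc n) (boxBound (suc n) m A adj? (λ i → proj₂ (proj₂ (B i))) {F = const ⊤} (λ _ → yes tt) items meets) ⟩
    2 ^ suc n * ∑ items weight
      ≡⟨ cong (2 ^ suc n *_) (trans (cong sum (sym (map-∘ M))) (∑-const M (suc (n + n)))) ⟩
    2 ^ suc n * (length M * suc (n + n))
      -- One factor 2 of the power is spent on turning the number of matching edges into the number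
      -- of vertices of `D`.
      ≡⟨ solve 3 (λ t l n → (con 2 :* t) :* (l :* (con 1 :+ (n :+ n))) := t :* (n :+ (con 1 :+ (n :+ con 0))) :* (l :* con 2)) refl (2 ^ n) (length M) n ⟩
    2 ^ n * (2 * suc n ∸ 1) * (length M * 2)
      ≡⟨ cong (2 ^ n * (2 * suc n ∸ 1) *_) (trans (sym (length-endpoints {G = □ (suc n) m A} M)) (trans (↭-length M↭D) |D|≡h)) ⟩
    2 ^ n * (2 * suc n ∸ 1) * h ∎
    where
    open ≤-Reasoning

    B : ∀ i → ∃ λ k → g i ≡ k * 2 × Blocks (A i) k
    B i = blocks (A i) (adj? i) (noIso i) (γ i)

    k : Fin (suc n) → ℕ
    k i = proj₁ (B i)

    items : List (Item (□ (suc n) m A))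
    items = map edge M

    meets : ∀ x → ⊤ → Meets (NearP (suc n) m A x) items
    meets x _ = let u , u∈D , near = dom x in
      map⁺ (concatMap⁻ _ {xs = M} (lose (∈-resp-↭ (↭-sym M↭D) u∈D) (nearP near)))
      where
      nearP : ∀ {u} → u ≡ x ⊎ ProdAdj (suc n) m A x u → NearP (suc n) m A x u
      -- A vertex dominating itself is assigned to the first direction, which exists since there is
      -- at least one factor.
      nearP (inj₁ refl) = inj₁ (inj₁ refl , refl)
      nearP (inj₂ e)    = ProdAdj⇒NearP (suc n) m A e
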